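{- There is no functional $\Lambda$ satisfying $\textsf{WFF}(\Lambda)$ which is computable in $\exists^2$; more generally, for any type two functional $\varphi:\mathbb{N}^{\mathbb{N}}\to\mathbb{N}$ there is no functional $\Lambda$ satisfying $\textsf{WFF}(\Lambda)$ which is computable in $\varphi$.
   Context: The metatheory is $\textsf{ZFC}$ and functionals live in the full (set-theoretic) type structure over $\mathbb{N}$. "Computable" (in given functionals) means Kleene computable via the schemes S1–S9. For $f\in\mathbb{N}^{\mathbb{N}}$, $\overline{f}N=\langle f(0),\dots,f(N-1)\rangle$; for a finite sequence $\sigma$, $[\sigma]$ is the set of $f\in2^{\mathbb{N}}$ extending $\sigma$. $\mathbf{m}$ is the usual coin-toss measure on $2^{\mathbb{N}}$. A functional $\Lambda$ of type $(2\times0)\to1^*$ assigns to every $G:\mathbb{N}^{\mathbb{N}}\to\mathbb{N}$ and $k\in\mathbb{N}$ a finite sequence $\Lambda(G,k)$ of elements of $\mathbb{N}^{\mathbb{N}}$. $\textsf{WFF}(\Lambda)$ ("$\Lambda$ is a weak fan functional") is the statement: for all $G:\mathbb{N}^{\mathbb{N}}\to\mathbb{N}$ and $k\in\mathbb{N}$, $\mathbf{m}\big(\bigcup_{g\in\Lambda(G,k)}[\overline{g}G(g)]\big)\geq1-\frac{1}{2^k}$. That such a $\Lambda$ is computable means that the (suitably coded) map giving the length of $\Lambda(G,k)$ and the values $\Lambda(G,k)(i)(n)$ is computable. $\exists^2:\mathbb{N}^{\mathbb{N}}\to\{0,1\}$ is the functional with $\exists^2(f)=0$ if and only if $(\exists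 n)(f(n)=0)$. -}

module Defs where

open import Axiom.ExcludedMiddle using (ExcludedMiddle)
open import Data.Bool using (Bool; true; if_then_else_)
open import Data.Fin using (Fin; zero; suc; toℕ)
open import Data.Integer using (+_)
open import Data.List using (List; []; _∷_; _++_; take; drop; length; lookup; applyUpTo)
open import Data.Nat using (ℕ; zero; suc; _+_; _*_; _^_; _≤_)
open import Data.Nat.Properties using (m^n≢0)
open import Data.Product using (Σ; ∃; ∃-syntax; _×_; _,_)
open import Data.Rational as ℚ using (ℚ; 1ℚ)
open import Data.Vec using (Vec; []; _∷_; tabulate)
open import Function using (_∘_; _⇔_; mk⇔)
open import Level using (0ℓ)
open import Relation.Binary.PropositionalEquality using (_≡_; refl)
open import Relation.Nullary using (does; yes; no; contradiction)
open import Relation.Unary using (Pred; ⋃)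

-- The full type structure over ℕ, restricted to the pure types.  Function
-- spaces are those of Agda; they stand for the set-theoretic ones only in the
-- presence of excluded middle and function extensionality, which are therefore
-- to be assumed wherever these definitions are used to speak about ZFC.

Tp : ℕ → Set
Tp zero    = ℕ
Tp (suc n) = Tp n → ℕ

Arg : Set
Arg = Σ ℕ Tp

pattern num x = zero , x
pattern fun f = suc zero , f

-- Indices carry no arities: an index that does not fit the argument list it is
-- applied to is simply undefined there.

data Index : Set where
  S1 S3 S7 : Index
  S2       : (q : ℕ) → Index
  S4 S5    : (e d : Index) → Index
  S6       : (k : ℕ) (e : Index) → Index
  S8       : (e : Index) → Index
  S9       : (l : ℕ) → Index

⟨_,_⟩ : ℕ → ℕ → ℕ
⟨ x , y ⟩ = 2 ^ x * (1 + 2 * y)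

-- Injective; numbers not of the form ⌜ e ⌝ are not indices of anything.

⌜_⌝ : Index → ℕ
⌜ S1 ⌝     = ⟨ 1 , 0 ⟩
⌜ S2 q ⌝   = ⟨ 2 , q ⟩
⌜ S3 ⌝     = ⟨ 3 , 0 ⟩
⌜ S4 e d ⌝ = ⟨ 4 , ⟨ ⌜ e ⌝ , ⌜ d ⌝ ⟩ ⟩
⌜ S5 e d ⌝ = ⟨ 5 , ⟨ ⌜ e ⌝ , ⌜ d ⌝ ⟩ ⟩
⌜ S6 k e ⌝ = ⟨ 6 , ⟨ k , ⌜ e ⌝ ⟩ ⟩
⌜ S7 ⌝     = ⟨ 7 , 0 ⟩
⌜ S8 e ⌝   = ⟨ 8 , ⌜ e ⌝ ⟩
⌜ S9 l ⌝   = ⟨ 9 , l ⟩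

infix 4 ⟦_⟧_≃_

-- ⟦ e ⟧ as ≃ m :  {e}(as) is defined with value m.
--
-- s6 moves the argument at position k (counting from 0) to the front, as in
-- Kleene's original formulation; such moves generate all permutations.
-- In s9, the index is applied to the first l of the remaining arguments only.

data ⟦_⟧_≃_ : Index → List Arg → ℕ → Set where
  s1   : ∀ {x as} → ⟦ S1 ⟧ num x ∷ as ≃ suc x
  s2   : ∀ {q as} → ⟦ S2 q ⟧ as ≃ q
  s3   : ∀ {x as} → ⟦ S3 ⟧ num x ∷ as ≃ x
  s4   : ∀ {e d as x m} →
         ⟦ d ⟧ as ≃ x → ⟦ e ⟧ num x ∷ as ≃ m → ⟦ S4 e d ⟧ as ≃ m
  s5-z : ∀ {e d as m} →
         ⟦ e ⟧ as ≃ m → ⟦ S5 e d ⟧ num 0 ∷ as ≃ m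
  s5-s : ∀ {e d x as y m} →
         ⟦ S5 e d ⟧ num x ∷ as ≃ y → ⟦ d ⟧ num x ∷ num y ∷ as ≃ m →
         ⟦ S5 e d ⟧ num (suc x) ∷ as ≃ m
  s6   : ∀ {k e as b bs m} →
         drop k as ≡ b ∷ bs → ⟦ e ⟧ b ∷ take k as ++ bs ≃ m →
         ⟦ S6 k e ⟧ as ≃ m
  s7   : ∀ {f x as} → ⟦ S7 ⟧ fun f ∷ num x ∷ as ≃ f x
  s8   : ∀ {e n} {F : Tp (suc (suc n))} {g : Tp (suc n)} {as} →
         (∀ σ → ⟦ e ⟧ (suc (suc n) , F) ∷ (n , σ) ∷ as ≃ g σ) →
         ⟦ S8 e ⟧ (suc (suc n) , F) ∷ as ≃ F g
  s9   : ∀ {l x e as m} →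
         x ≡ ⌜ e ⌝ → l ≤ length as → ⟦ e ⟧ take l as ≃ m →
         ⟦ S9 l ⟧ num x ∷ as ≃ m

Cantor : Set
Cantor = ℕ → Fin 2

overline : (ℕ → ℕ) → ℕ → List ℕ
overline f N = applyUpTo f N

-- Sequences with an entry other than 0 and 1 have no extension in Cantor.

[_] : List ℕ → Pred Cantor 0ℓ
[ σ ] f = overline (toℕ ∘ f) (length σ) ≡ σ

count : (N : ℕ) → (Vec (Fin 2) N → Bool) → ℕ
count zero    S = if S [] then 1 else 0
count (suc N) S = count N (λ τ → S (zero ∷ τ)) + count N (λ τ → S (suc zero ∷ τ))

_/2^_ : ℕ → ℕ → ℚ
a /2^ n = ℚ._/_ (+ a) (2 ^ n) {{m^n≢0 2 n}}

-- The coin-toss measure on the algebra of clopen sets, to which all finite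
-- unions of cylinders belong: if membership in A is decided by the outcome of
-- the first N tosses, the measure of A is the proportion of favourable
-- outcomes among the 2^N possible ones (independently of the choice of N).

_hasMeasure_ : Pred Cantor 0ℓ → ℚ → Set
A hasMeasure q =
  ∃[ N ] Σ (Vec (Fin 2) N → Bool) λ S →
    (∀ f → A f ⇔ S (tabulate (f ∘ toℕ)) ≡ true) × q ≡ count N S /2^ N

WeakFanType : Set
WeakFanType = Tp 2 → ℕ → List (ℕ → ℕ)

covered : Tp 2 → List (ℕ → ℕ) → Pred Cantor 0ℓ
covered G gs = ⋃[ i ∶ Fin (length gs) ] [ overline (lookup gs i) (G (lookup gs i)) ]

WFF : WeakFanType → Set
WFF Λ = ∀ (G : Tp 2) (k : ℕ) →
  ∃[ q ] (covered G (Λ G k) hasMeasure q) × q ℚ.≥ 1ℚ ℚ.- (1 /2^ k)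

-- A finite sequence of functions is coded by its length and its entries.
-- Nothing is required of {d} at positions beyond the length.

_ComputableIn_ : WeakFanType → Tp 2 → Set
Λ ComputableIn φ =
  (∃[ e ] ∀ (G : Tp 2) (k : ℕ) →
     ⟦ e ⟧ (2 , φ) ∷ (2 , G) ∷ num k ∷ [] ≃ length (Λ G k)) ×
  (∃[ d ] ∀ (G : Tp 2) (k : ℕ) (i : Fin (length (Λ G k))) (n : ℕ) →
     ⟦ d ⟧ (2 , φ) ∷ (2 , G) ∷ num k ∷ num (toℕ i) ∷ num n ∷ [] ≃ lookup (Λ G k) i n)

∃² : ExcludedMiddle 0ℓ → Tp 2
∃² em f = if does (em {∃[ n ] f n ≡ 0}) then 0 else 1

∃²-spec : (em : ExcludedMiddle 0ℓ) (f : ℕ → ℕ) → ∃² em f ≡ 0 ⇔ (∃[ n ] f n ≡ 0)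
∃²-spec em f with em {∃[ n ] f n ≡ 0}
... | yes p = mk⇔ (λ _ → p) (λ _ → refl)
... | no ¬p = mk⇔ (λ ()) (λ p → contradiction p ¬p)

{-# OPTIONS --safe #-}
module Submission where

-- Computations with arguments φ and G query G only at functions that they
-- themselves compute.  So it suffices to find G whose values at the functions
-- computable from φ and G are pairwise distinct: the entries of Λ(G,1) are such
-- functions, and give at most one cylinder for each length.  To get G, let the
-- value at g name a computation of g from φ and the partial functional G, and
-- run through all m, extending G whenever some such extension takes the value m.
-- Since computing from a partial functional is monotone in it and
-- single-valued, the union of the chain is defined at everything it computes.

open import Defs
open import Axiom.ExcludedMiddle using (ExcludedMiddle)
open import Axiom.Extensionality.Propositional using (Extensionality)
open import Data.Bool using (Bool; true; false; _∧_; _∨_; if_then_else_)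
open import Data.Bool.Properties using (∨-zeroʳ)
open import Data.Fin using (Fin; zero; suc; toℕ)
import Data.Integer as ℤ
import Data.Integer.Properties as ℤ
open import Data.List using (List; []; _∷_; _++_; map; take; drop; length; lookup)
open import Data.List.Properties
  using (take-map; drop-map; map-++; length-map; length-applyUpTo; ∷-injective)
open import Data.Nat using (ℕ; zero; suc; _+_; _*_; _∸_; _^_; _≤_; _<_; z≤n; s≤s; _≡ᵇ_; NonZero)
open import Data.Nat.ListAction using (sum)
open import Data.Nat.Properties
open import Data.Nat.Solver using (module +-*-Solver)
open import Data.Product using (∃; ∃-syntax; _×_; _,_; proj₁; proj₂)
import Data.Rational as ℚ
import Data.Rational.Properties as ℚ
import Data.Rational.Unnormalised as ℚᵘ
import Data.Rational.Unnormalised.Properties as ℚᵘ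
open import Data.Sum using (inj₁; inj₂)
open import Data.Vec using (Vec; []; _∷_; tabulate)
open import Function using (_∘_; Equivalence)
open import Level using (0ℓ)
open import Relation.Binary.PropositionalEquality
  using (_≡_; refl; sym; trans; cong; cong₂; subst; subst₂)
open import Relation.Nullary using (¬_; Dec; yes; no; contradiction)

-- Injectivity of the coding of indices.

⟨,⟩-injective : ∀ x y x' y' → ⟨ x , y ⟩ ≡ ⟨ x' , y' ⟩ → x ≡ x' × y ≡ y'
⟨,⟩-injective zero y zero y' eq =
  refl , *-cancelˡ-≡ y y' 2 (suc-injective (subst₂ _≡_ (*-identityˡ _) (*-identityˡ _) eq))
-- The odd number `1 + 2 * y` would equal an even one; the next case is symmetric.
⟨,⟩-injective zero y (suc x') y' eq =
  contradiction (trans (sym (*-assoc 2 (2 ^ x') _)) (trans (sym eq) (*-identityˡ _)))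
                (even≢odd ⟨ x' , y' ⟩ y)
⟨,⟩-injective (suc x) y zero y' eq =
  contradiction (trans (sym (*-assoc 2 (2 ^ x) _)) (trans eq (*-identityˡ _)))
                (even≢odd ⟨ x , y ⟩ y')
⟨,⟩-injective (suc x) y (suc x') y' eq
  with refl , refl ← ⟨,⟩-injective x y x' y'
         (*-cancelˡ-≡ _ _ 2 (trans (sym (*-assoc 2 (2 ^ x) _)) (trans eq (*-assoc 2 (2 ^ x') _))))
  = refl , refl

-- Every code is written uniformly as one pair, so that a single use of `⟨,⟩-injective` compares the
-- outermost constructors; distinct tags then rule out all pairs of different constructors.
tag body : Index → ℕ
tag S1       = 1
tag (S2 _)   = 2
tag S3       = 3
tag (S4 _ _) = 4
tag (S5 _ _) = 5
tag (S6 _ _) = 6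
tag S7       = 7
tag (S8 _)   = 8
tag (S9 _)   = 9
body S1       = 0
body (S2 q)   = q
body S3       = 0
body (S4 e d) = ⟨ ⌜ e ⌝ , ⌜ d ⌝ ⟩
body (S5 e d) = ⟨ ⌜ e ⌝ , ⌜ d ⌝ ⟩
body (S6 k e) = ⟨ k , ⌜ e ⌝ ⟩
body S7       = 0
body (S8 e)   = ⌜ e ⌝
body (S9 l)   = l

⌜⌝≡⟨tag,body⟩ : ∀ e → ⌜ e ⌝ ≡ ⟨ tag e , body e ⟩
⌜⌝≡⟨tag,body⟩ S1       = refl
⌜⌝≡⟨tag,body⟩ (S2 _)   = refl
⌜⌝≡⟨tag,body⟩ S3       = refl
⌜⌝≡⟨tag,body⟩ (S4 _ _) = refl
⌜⌝≡⟨tag,body⟩ (S5 _ _) = refl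
⌜⌝≡⟨tag,body⟩ (S6 _ _) = refl
⌜⌝≡⟨tag,body⟩ S7       = refl
⌜⌝≡⟨tag,body⟩ (S8 _)   = refl
⌜⌝≡⟨tag,body⟩ (S9 _)   = refl

mutual
  ⌜⌝-injective : ∀ e e' → ⌜ e ⌝ ≡ ⌜ e' ⌝ → e ≡ e'
  ⌜⌝-injective e e' eq = tag-body-injective e e' (proj₁ tb) (proj₂ tb)
    where
    tb = ⟨,⟩-injective (tag e) (body e) (tag e') (body e')
           (trans (sym (⌜⌝≡⟨tag,body⟩ e)) (trans eq (⌜⌝≡⟨tag,body⟩ e')))

  tag-body-injective : ∀ e e' → tag e ≡ tag e' → body e ≡ body e' → e ≡ e'
  tag-body-injective S1 S1 refl _ = refl
  tag-body-injective (S2 q) (S2 q') refl eq = cong S2 eq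
  tag-body-injective S3 S3 refl _ = refl
  tag-body-injective (S4 e d) (S4 e' d') refl eq
    with p , q ← ⟨,⟩-injective (⌜ e ⌝) (⌜ d ⌝) (⌜ e' ⌝) (⌜ d' ⌝) eq
    = cong₂ S4 (⌜⌝-injective e e' p) (⌜⌝-injective d d' q)
  tag-body-injective (S5 e d) (S5 e' d') refl eq
    with p , q ← ⟨,⟩-injective (⌜ e ⌝) (⌜ d ⌝) (⌜ e' ⌝) (⌜ d' ⌝) eq
    = cong₂ S5 (⌜⌝-injective e e' p) (⌜⌝-injective d d' q)
  tag-body-injective (S6 k e) (S6 k' e') refl eq
    with p , q ← ⟨,⟩-injective k (⌜ e ⌝) k' (⌜ e' ⌝) eq
    = cong₂ S6 p (⌜⌝-injective e e' q)
  tag-body-injective S7 S7 refl _ = refl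
  tag-body-injective (S8 e) (S8 e') refl eq = cong S8 (⌜⌝-injective e e' eq)
  tag-body-injective (S9 l) (S9 l') refl eq = cong S9 eq

-- Symbolic computations relative to partial oracles.

-- Computations from type-two arguments only ever meet numbers and those very
-- arguments, so the latter may be replaced by symbols.

data Sym : Set where
  nat    : ℕ → Sym
  oracle : Bool → Sym

-- Relations rather than functions, so that an oracle may be undefined. Later `true` stands for `φ`
-- and `false` for the functional under construction.
Oracles : Set₁
Oracles = Bool → (ℕ → ℕ) → ℕ → Set

infix 4 _⊢_·_↦_

-- `S7` has no rule because no symbol denotes a function of type one. `R` enters only as a premise
-- of `s8`, which is what makes the relation monotone in `R`.
data _⊢_·_↦_ (R : Oracles) : Index → List Sym → ℕ → Set where
  s1   : ∀ {x as} → R ⊢ S1 · nat x ∷ as ↦ suc x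
  s2   : ∀ {q as} → R ⊢ S2 q · as ↦ q
  s3   : ∀ {x as} → R ⊢ S3 · nat x ∷ as ↦ x
  s4   : ∀ {e d as x m} →
         R ⊢ d · as ↦ x → R ⊢ e · nat x ∷ as ↦ m → R ⊢ S4 e d · as ↦ m
  s5-z : ∀ {e d as m} →
         R ⊢ e · as ↦ m → R ⊢ S5 e d · nat 0 ∷ as ↦ m
  s5-s : ∀ {e d x as y m} →
         R ⊢ S5 e d · nat x ∷ as ↦ y → R ⊢ d · nat x ∷ nat y ∷ as ↦ m →
         R ⊢ S5 e d · nat (suc x) ∷ as ↦ m
  s6   : ∀ {k e as b bs m} →
         drop k as ≡ b ∷ bs → R ⊢ e · b ∷ take k as ++ bs ↦ m →
         R ⊢ S6 k e · as ↦ m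
  s8   : ∀ {e b g as m} →
         (∀ n → R ⊢ e · oracle b ∷ nat n ∷ as ↦ g n) → R b g m →
         R ⊢ S8 e · oracle b ∷ as ↦ m
  s9   : ∀ {l x e as m} →
         x ≡ ⌜ e ⌝ → l ≤ length as → R ⊢ e · take l as ↦ m →
         R ⊢ S9 l · nat x ∷ as ↦ m

↦-mono : ∀ {R R' : Oracles} → (∀ b g m → R b g m → R' b g m) →
         ∀ {e as m} → R ⊢ e · as ↦ m → R' ⊢ e · as ↦ m
↦-mono R⊆R' s1           = s1
↦-mono R⊆R' s2           = s2
↦-mono R⊆R' s3           = s3
↦-mono R⊆R' (s4 c c')    = s4 (↦-mono R⊆R' c) (↦-mono R⊆R' c')
↦-mono R⊆R' (s5-z c)     = s5-z (↦-mono R⊆R' c)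
↦-mono R⊆R' (s5-s c c')  = s5-s (↦-mono R⊆R' c) (↦-mono R⊆R' c')
↦-mono R⊆R' (s6 eq c)    = s6 eq (↦-mono R⊆R' c)
↦-mono R⊆R' (s8 c r)     = s8 (λ n → ↦-mono R⊆R' (c n)) (R⊆R' _ _ _ r)
↦-mono R⊆R' (s9 eq le c) = s9 eq le (↦-mono R⊆R' c)

-- Two cases go beyond induction: in `s8` the subcomputations determine the queried function only
-- pointwise, hence extensionality, and in `s9` the index must be recovered from its code.
↦-functional : Extensionality 0ℓ 0ℓ → ∀ {R : Oracles} →
               (∀ b g {m m'} → R b g m → R b g m' → m ≡ m') →
               ∀ {e as m m'} → R ⊢ e · as ↦ m → R ⊢ e · as ↦ m' → m ≡ m'
↦-functional ext {R} R-fun = go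
  where
  go : ∀ {e as m m'} → R ⊢ e · as ↦ m → R ⊢ e · as ↦ m' → m ≡ m'
  go s1 s1 = refl
  go s2 s2 = refl
  go s3 s3 = refl
  go (s4 c₁ c₂) (s4 d₁ d₂) with refl ← go c₁ d₁ = go c₂ d₂
  go (s5-z c) (s5-z d) = go c d
  go (s5-s c₁ c₂) (s5-s d₁ d₂) with refl ← go c₁ d₁ = go c₂ d₂
  go (s6 p c) (s6 q d) with refl ← trans (sym p) q = go c d
  go (s8 {g = g} c r) (s8 {g = g'} d r')
    with refl ← ext {f = g} {g = g'} (λ n → go (c n) (d n)) = R-fun _ g r r'
  go (s9 {e = e} p _ c) (s9 {e = e'} q _ d)
    with refl ← ⌜⌝-injective e e' (trans (sym p) q) = go c d

-- Numerical names for an index together with its parameters.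

codeSym : Sym → ℕ
codeSym (nat x)        = ⟨ 0 , x ⟩
codeSym (oracle false) = ⟨ 1 , 0 ⟩
codeSym (oracle true)  = ⟨ 2 , 0 ⟩

codeSym-injective : ∀ s t → codeSym s ≡ codeSym t → s ≡ t
codeSym-injective (nat x) (nat y) eq with refl , refl ← ⟨,⟩-injective 0 x 0 y eq = refl
codeSym-injective (nat x) (oracle false) eq with () ← proj₁ (⟨,⟩-injective 0 x 1 0 eq)
codeSym-injective (nat x) (oracle true) eq with () ← proj₁ (⟨,⟩-injective 0 x 2 0 eq)
codeSym-injective (oracle false) (nat x) eq with () ← proj₁ (⟨,⟩-injective 1 0 0 x eq)
codeSym-injective (oracle true) (nat x) eq with () ← proj₁ (⟨,⟩-injective 2 0 0 x eq)
codeSym-injective (oracle false) (oracle false) eq = refl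
codeSym-injective (oracle true) (oracle true) eq = refl

codeSyms : List Sym → ℕ
codeSyms []       = 0
codeSyms (s ∷ ss) = suc ⟨ codeSym s , codeSyms ss ⟩

codeSyms-injective : ∀ ss ts → codeSyms ss ≡ codeSyms ts → ss ≡ ts
codeSyms-injective [] [] _ = refl
codeSyms-injective (s ∷ ss) (t ∷ ts) eq
  with p , q ← ⟨,⟩-injective (codeSym s) (codeSyms ss) (codeSym t) (codeSyms ts) (suc-injective eq)
  = cong₂ _∷_ (codeSym-injective s t p) (codeSyms-injective ss ts q)

-- The shift by 2 keeps the total measure of one cylinder for each length that
-- is a code below 1/2.

code : Index → List Sym → ℕ
code e as = 2 + ⟨ ⌜ e ⌝ , codeSyms as ⟩

code-injective : ∀ e as e' as' → code e as ≡ code e' as' → e ≡ e' × as ≡ as'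
code-injective e as e' as' eq
  with p , q ← ⟨,⟩-injective ⌜ e ⌝ (codeSyms as) ⌜ e' ⌝ (codeSyms as')
                 (suc-injective (suc-injective eq))
  = ⌜⌝-injective e e' p , codeSyms-injective as as' q

-- Partial functionals whose values name their arguments.

-- A functional is read as a partial one that is undefined where its value is
-- below 2.

module Partial (em : ExcludedMiddle 0ℓ) (ext : Extensionality 0ℓ 0ℓ) (φ : Tp 2) where

  oracles : Tp 2 → Oracles
  oracles p true  g m = φ g ≡ m
  oracles p false g m = 2 ≤ m × p g ≡ m

  Computes : Tp 2 → Index → List Sym → (ℕ → ℕ) → Set
  Computes p e as g = ∀ n → oracles p ⊢ e · nat n ∷ as ↦ g n

  infix 4 _⊑_

  _⊑_ : Tp 2 → Tp 2 → Set
  p ⊑ q = ∀ {g} → 2 ≤ p g → q g ≡ p g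

  ⊑-refl : ∀ {p} → p ⊑ p
  ⊑-refl _ = refl

  ⊑-trans : ∀ {p q r} → p ⊑ q → q ⊑ r → p ⊑ r
  ⊑-trans p⊑q q⊑r 2≤p = trans (q⊑r (subst (2 ≤_) (sym (p⊑q 2≤p)) 2≤p)) (p⊑q 2≤p)

  Computes-mono : ∀ {p q} → p ⊑ q → ∀ {e as g} → Computes p e as g → Computes q e as g
  Computes-mono {p} {q} p⊑q c n = ↦-mono oracles-mono (c n)
    where
    oracles-mono : ∀ b g m → oracles p b g m → oracles q b g m
    oracles-mono true  g m r            = r
    oracles-mono false g m (2≤m , refl) = 2≤m , p⊑q 2≤m

  Computes-functional : ∀ {p e as g g'} → Computes p e as g → Computes p e as g' → g ≡ g'
  Computes-functional {p} c c' = ext (λ n → ↦-functional ext oracles-functional (c n) (c' n))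
    where
    oracles-functional : ∀ b g {m m'} → oracles p b g m → oracles p b g m' → m ≡ m'
    oracles-functional true  g r       r'       = trans (sym r) r'
    oracles-functional false g (_ , r) (_ , r') = trans (sym r) r'

  -- Soundness of the naming, where the named computation may itself query `p`; `Closed` is the
  -- matching completeness.
  Good : Tp 2 → Set
  Good p = ∀ {g} → 2 ≤ p g → ∃[ e ] ∃[ as ] p g ≡ code e as × Computes p e as g

  Closed : Tp 2 → Set
  Closed p = ∀ {e as g} → Computes p e as g → 2 ≤ p g

  Good⇒Computes : ∀ {p} → Good p → ∀ {e as g} → p g ≡ code e as → Computes p e as g
  Good⇒Computes good {e} {as} pg≡
    with e' , as' , pg≡' , c ← good (subst (2 ≤_) (sym pg≡) (m≤m+n 2 _))
    with refl , refl ← code-injective e as e' as' (trans (sym pg≡) pg≡')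
    = c

  -- Equal values are the same name, and one name computes at most one function.
  Good⇒injective : ∀ {p} → Good p → ∀ {g g'} → 2 ≤ p g → p g ≡ p g' → g ≡ g'
  Good⇒injective good 2≤pg eq with e , as , pg≡ , c ← good 2≤pg
    = Computes-functional c (Good⇒Computes good (trans (sym eq) pg≡))

  _[_↦_] : Tp 2 → (ℕ → ℕ) → ℕ → Tp 2
  (p [ f ↦ m ]) g with em {g ≡ f}
  ... | yes _ = m
  ... | no  _ = p g

  update-same : ∀ p f m → (p [ f ↦ m ]) f ≡ m
  update-same p f m with em {f ≡ f}
  ... | yes _  = refl
  ... | no f≢f = contradiction refl f≢f

  update-other : ∀ p f m {g} → ¬ g ≡ f → (p [ f ↦ m ]) g ≡ p g
  update-other p f m {g} g≢f with em {g ≡ f}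
  ... | yes g≡f = contradiction g≡f g≢f
  ... | no _    = refl

  ⊑-update : ∀ p f m → ¬ 2 ≤ p f → p ⊑ p [ f ↦ m ]
  ⊑-update p f m ¬2≤pf 2≤pg = update-other p f m λ { refl → ¬2≤pf 2≤pg }

  -- All names, including the new one at `f`, refer to computations from `p`; these persist because
  -- the update extends `p`.
  Good-update : ∀ {p e as f} → Good p → Computes p e as f → ¬ 2 ≤ p f → Good (p [ f ↦ code e as ])
  Good-update {p} {e} {as} {f} good c ¬2≤pf {g} 2≤ = named em
    where
    p′ : Tp 2
    p′ = p [ f ↦ code e as ]
    p⊑p′ : p ⊑ p′
    p⊑p′ = ⊑-update p f (code e as) ¬2≤pf
    named : Dec (g ≡ f) → ∃[ e' ] ∃[ as' ] p′ g ≡ code e' as' × Computes p′ e' as' g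
    named (yes refl) = e , as , update-same p f (code e as) , Computes-mono p⊑p′ c
    named (no g≢f)
      with same ← update-other p f (code e as) g≢f
      with e' , as' , pg≡ , c' ← good (subst (2 ≤_) same 2≤)
      = e' , as' , trans same pg≡ , Computes-mono p⊑p′ c'

  -- The chain of good functionals and its union.

  ExtensionHitting : ℕ → Tp 2 → Set
  ExtensionHitting m p = ∃[ q ] Good q × p ⊑ q × ∃[ g ] q g ≡ m

  -- Any good extension taking the value `m` is accepted, not only one that adds a single point: in
  -- `Closed-G` the candidate is an update of the whole union `G`.
  next : ℕ → ∃ Good → ∃ Good
  next m (p , good) with em {ExtensionHitting m p}
  ... | yes (q , good' , _) = q , good'
  ... | no _                = p , good

  stage : ℕ → ∃ Good
  -- The constant 0 is nowhere defined, so it is good vacuously.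
  stage zero    = (λ _ → 0) , λ ()
  stage (suc m) = next m (stage m)

  P : ℕ → Tp 2
  P m = proj₁ (stage m)

  P-step : ∀ m → P m ⊑ P (suc m)
  P-step m with em {ExtensionHitting m (P m)}
  ... | yes (_ , _ , p⊑q , _) = p⊑q
  ... | no _                  = ⊑-refl {P m}

  P-hits : ∀ m → ExtensionHitting m (P m) → ∃[ g ] P (suc m) g ≡ m
  P-hits m h with em {ExtensionHitting m (P m)}
  ... | yes (_ , _ , _ , hit) = hit
  ... | no ¬h                 = contradiction h ¬h

  P-mono′ : ∀ m k → P m ⊑ P (k + m)
  P-mono′ m zero    = ⊑-refl {P m}
  P-mono′ m (suc k) = ⊑-trans {P m} {P (k + m)} {P (suc k + m)} (P-mono′ m k) (P-step (k + m))

  P-mono : ∀ {m n} → m ≤ n → P m ⊑ P n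
  P-mono {m} {n} m≤n = subst (λ k → P m ⊑ P k) (m∸n+n≡m m≤n) (P-mono′ m (n ∸ m))

  G : Tp 2
  G g with em {∃[ n ] 2 ≤ P n g}
  ... | yes (n , _) = P n g
  ... | no _        = 0

  -- The stage `n'` that `G` reads may differ from `n`, but one of the two extends the other, so
  -- they agree at `g`.
  P⊑G : ∀ n → P n ⊑ G
  P⊑G n {g} 2≤ with em {∃[ n ] 2 ≤ P n g}
  ... | no ¬h = contradiction (n , 2≤) ¬h
  ... | yes (n' , 2≤') with ≤-total n n'
  ...   | inj₁ n≤n' = P-mono n≤n' 2≤
  ...   | inj₂ n'≤n = sym (P-mono n'≤n 2≤')

  G-stage : ∀ {g} → 2 ≤ G g → ∃[ n ] 2 ≤ P n g
  G-stage {g} 2≤ with em {∃[ n ] 2 ≤ P n g}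
  ... | yes h = h
  ... | no _ with () ← 2≤

  Good-G : Good G
  Good-G 2≤ with n , 2≤P ← G-stage 2≤
             with e , as , eq , c ← proj₂ (stage n) 2≤P
    = e , as , trans (P⊑G n 2≤P) eq , Computes-mono (P⊑G n) c

  -- If G omitted f, the update of G at f would be an extension of the stage
  -- m = code e as that hits m, so m is the G-value of some g, which by goodness
  -- is f itself.

  Closed-G : Closed G
  Closed-G {e} {as} {f} c with em {2 ≤ G f}
  ... | yes 2≤Gf = 2≤Gf
  ... | no ¬2≤Gf = contradiction (subst (λ h → 2 ≤ G h) g≡f 2≤Gg) ¬2≤Gf
    where
    m : ℕ
    m = code e as
    hit : ∃[ g ] P (suc m) g ≡ m
    hit = P-hits m
      ( G [ f ↦ m ] , Good-update Good-G c ¬2≤Gf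
      , ⊑-trans {P m} {G} {G [ f ↦ m ]} (P⊑G m) (⊑-update G f m ¬2≤Gf)
      , f , update-same G f m)
    g : ℕ → ℕ
    g = proj₁ hit
    2≤Pg : 2 ≤ P (suc m) g
    2≤Pg = subst (2 ≤_) (sym (proj₂ hit)) (m≤m+n 2 _)
    Gg≡m : G g ≡ m
    Gg≡m = trans (P⊑G (suc m) 2≤Pg) (proj₂ hit)
    2≤Gg : 2 ≤ G g
    2≤Gg = subst (2 ≤_) (sym Gg≡m) (m≤m+n 2 _)
    g≡f : g ≡ f
    g≡f = Computes-functional (Good⇒Computes Good-G Gg≡m) c

  -- From Kleene computations to symbolic ones.

  arg : Sym → Arg
  arg (nat x)        = num x
  arg (oracle true)  = 2 , φ
  arg (oracle false) = 2 , G

  map≡∷ : ∀ (ss : List Sym) {a as} → map arg ss ≡ a ∷ as →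
          ∃[ t ] ∃[ ts ] ss ≡ t ∷ ts × arg t ≡ a × map arg ts ≡ as
  map≡∷ (t ∷ ts) refl = t , ts , refl , refl , refl

  num-arg : ∀ (ss : List Sym) {x as} → map arg ss ≡ num x ∷ as →
            ∃[ ts ] ss ≡ nat x ∷ ts × map arg ts ≡ as
  num-arg (nat x ∷ ts)        refl = ts , refl , refl
  num-arg (oracle true ∷ ts)  ()
  num-arg (oracle false ∷ ts) ()

  -- `s8` supplies the number after the oracle, whereas `Computes` wants it in front; `S6 1` swaps
  -- the two.
  Computes-front : ∀ {p e b as g} → (∀ n → oracles p ⊢ e · oracle b ∷ nat n ∷ as ↦ g n) →
                   Computes p (S6 1 e) (oracle b ∷ as) g
  Computes-front c n = s6 refl (c n)

  -- The functions to which G is applied along a computation are themselves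
  -- computed, hence in the domain of G.

  ≃⇒↦ : ∀ {e as m} → ⟦ e ⟧ as ≃ m → ∀ ss → map arg ss ≡ as → oracles G ⊢ e · ss ↦ m
  ≃⇒↦ s1 ss eq with _ , refl , _ ← num-arg ss eq = s1
  ≃⇒↦ s2 ss eq = s2
  ≃⇒↦ s3 ss eq with _ , refl , _ ← num-arg ss eq = s3
  ≃⇒↦ (s4 c c') ss eq = s4 (≃⇒↦ c ss eq) (≃⇒↦ c' (nat _ ∷ ss) (cong (_ ∷_) eq))
  ≃⇒↦ (s5-z c) ss eq with ts , refl , eq' ← num-arg ss eq = s5-z (≃⇒↦ c ts eq')
  ≃⇒↦ (s5-s c c') ss eq with ts , refl , refl ← num-arg ss eq =
    s5-s (≃⇒↦ c (nat _ ∷ ts) refl) (≃⇒↦ c' (nat _ ∷ nat _ ∷ ts) refl)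
  ≃⇒↦ (s6 {k} p c) ss refl
    with t , ts , eq , refl , refl ← map≡∷ (drop k ss) (trans (sym (drop-map k ss)) p) =
    s6 eq (≃⇒↦ c (t ∷ take k ss ++ ts) (cong (arg t ∷_)
      (trans (map-++ arg (take k ss) ts) (cong (_++ map arg ts) (sym (take-map k ss))))))
  ≃⇒↦ s7 (nat _ ∷ _) ()
  ≃⇒↦ s7 (oracle true ∷ _) ()
  ≃⇒↦ s7 (oracle false ∷ _) ()
  ≃⇒↦ (s8 c) (oracle true ∷ ts) refl = s8 (λ n → ≃⇒↦ (c n) (oracle true ∷ nat n ∷ ts) refl) refl
  ≃⇒↦ (s8 {e = e} c) (oracle false ∷ ts) refl =
    s8 c' (Closed-G (Computes-front c') , refl)
    where c' = λ n → ≃⇒↦ (c n) (oracle false ∷ nat n ∷ ts) refl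
  ≃⇒↦ (s8 _) (nat _ ∷ _) ()
  ≃⇒↦ (s9 {l} p le c) ss eq with ts , refl , refl ← num-arg ss eq =
    s9 p (subst (l ≤_) (length-map arg ts) le) (≃⇒↦ c (take l ts) (sym (take-map l ts)))

  entries-in-domain : ∀ {Λ} → Λ ComputableIn φ → ∀ k i → 2 ≤ G (lookup (Λ G k) i)
  entries-in-domain (_ , d , computes) k i =
    Closed-G {as = oracle true ∷ oracle false ∷ nat k ∷ nat (toℕ i) ∷ []} λ n →
      -- Each `S6 4` moves the last of five arguments to the front, so four of them carry `n` from
      -- the front to the end, where `d` expects it.
      s6 {k = 4} refl (s6 {k = 4} refl (s6 {k = 4} refl (s6 {k = 4} refl
        (≃⇒↦ (computes G k i n)
          (oracle true ∷ oracle false ∷ nat k ∷ nat (toℕ i) ∷ nat n ∷ []) refl))))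

-- Counting outcomes of finitely many tosses.

count-const : ∀ N b → count N (λ _ → b) ≡ (if b then 2 ^ N else 0)
count-const zero    b     = refl
count-const (suc N) false = cong₂ _+_ (count-const N false) (count-const N false)
count-const (suc N) true  =
  cong₂ _+_ (count-const N true) (trans (count-const N true) (sym (+-identityʳ _)))

count-mono : ∀ N {S T : Vec (Fin 2) N → Bool} →
             (∀ τ → S τ ≡ true → T τ ≡ true) → count N S ≤ count N T
count-mono zero {S} {T} S⊆T with S [] | T [] | S⊆T []
... | false | _     | _ = z≤n
... | true  | true  | _ = ≤-refl
... | true  | false | h with () ← h refl
count-mono (suc N) S⊆T =
  +-mono-≤ (count-mono N (S⊆T ∘ (zero ∷_))) (count-mono N (S⊆T ∘ (suc zero ∷_)))

count-∨ : ∀ N (S T : Vec (Fin 2) N → Bool) → count N (λ τ → S τ ∨ T τ) ≤ count N S + count N T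
count-∨ zero S T with S [] | T []
... | false | _     = ≤-refl
... | true  | false = ≤-refl
... | true  | true  = s≤s z≤n
count-∨ (suc N) S T = begin
  count N (λ τ → S (zero ∷ τ) ∨ T (zero ∷ τ)) + count N (λ τ → S (suc zero ∷ τ) ∨ T (suc zero ∷ τ))
    ≤⟨ +-mono-≤ (count-∨ N (S ∘ (zero ∷_)) (T ∘ (zero ∷_)))
                (count-∨ N (S ∘ (suc zero ∷_)) (T ∘ (suc zero ∷_))) ⟩
  (s₀ + t₀) + (s₁ + t₁)
    ≡⟨ solve 4 (λ a b c d → (a :+ b) :+ (c :+ d) := (a :+ c) :+ (b :+ d)) refl s₀ t₀ s₁ t₁ ⟩
  (s₀ + s₁) + (t₀ + t₁) ∎
  where
  open ≤-Reasoning
  open +-*-Solver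
  s₀ = count N (S ∘ (zero ∷_))
  s₁ = count N (S ∘ (suc zero ∷_))
  t₀ = count N (T ∘ (zero ∷_))
  t₁ = count N (T ∘ (suc zero ∷_))

padded : ∀ {N} → Vec (Fin 2) N → Cantor
padded []      _       = zero
padded (b ∷ τ) zero    = b
padded (b ∷ τ) (suc n) = padded τ n

-- Truncation to `N` tosses, expressed through `padded` so that it has the form in which
-- `_hasMeasure_` applies its decision function.
initial : ∀ N {K} → Vec (Fin 2) (N + K) → Vec (Fin 2) N
initial N τ = tabulate (padded τ ∘ toℕ)

-- Each outcome of `N` tosses has `2 ^ K` continuations.
count-initial : ∀ N K (S : Vec (Fin 2) N → Bool) →
                count (N + K) (S ∘ initial N {K}) ≡ 2 ^ K * count N S
count-initial zero K S with S [] | count-const K (S [])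
... | false | eq = trans eq (sym (*-zeroʳ (2 ^ K)))
... | true  | eq = trans eq (sym (*-identityʳ (2 ^ K)))
count-initial (suc N) K S =
  trans (cong₂ _+_ (count-initial N K (S ∘ (zero ∷_))) (count-initial N K (S ∘ (suc zero ∷_))))
        (sym (*-distribˡ-+ (2 ^ K) _ _))

startsWith : ∀ {M} → List ℕ → Vec (Fin 2) M → Bool
startsWith []      _       = true
startsWith (_ ∷ _) []      = false
startsWith (x ∷ σ) (b ∷ τ) = (toℕ b ≡ᵇ x) ∧ startsWith σ τ

-- Each entry of `σ` is matched by at most one of the two bits and so at least halves the count. If
-- `σ` is longer than `M`, the count is 0.
count-startsWith : ∀ M σ → count M (startsWith σ) * 2 ^ length σ ≤ 2 ^ M
count-startsWith M [] = ≤-reflexive (trans (*-identityʳ _) (count-const M true))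
count-startsWith zero (x ∷ σ) = z≤n
count-startsWith (suc M) (x ∷ σ) = begin
  (count M (λ τ → (0 ≡ᵇ x) ∧ startsWith σ τ) + count M (λ τ → (1 ≡ᵇ x) ∧ startsWith σ τ)) * (2 * 2 ^ length σ)
    ≤⟨ *-monoˡ-≤ (2 * 2 ^ length σ) (one-half x) ⟩
  c * (2 * 2 ^ length σ)
    ≡⟨ solve 2 (λ a b → a :* (con 2 :* b) := con 2 :* (a :* b)) refl c (2 ^ length σ) ⟩
  2 * (c * 2 ^ length σ)
    ≤⟨ *-monoʳ-≤ 2 (count-startsWith M σ) ⟩
  2 * 2 ^ M ∎
  where
  open ≤-Reasoning
  open +-*-Solver
  c = count M (startsWith σ)
  one-half : ∀ x → count M (λ τ → (0 ≡ᵇ x) ∧ startsWith σ τ) +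
                   count M (λ τ → (1 ≡ᵇ x) ∧ startsWith σ τ) ≤ c
  one-half 0 = ≤-reflexive (trans (cong (c +_) (count-const M false)) (+-identityʳ c))
  one-half 1 = ≤-reflexive (cong (_+ c) (count-const M false))
  one-half (suc (suc _)) =
    ≤-trans (≤-reflexive (cong₂ _+_ (count-const M false) (count-const M false))) z≤n

-- The length bound ensures that the zeros added by `padded` are never consulted.
[]⇒startsWith : ∀ {M} σ (τ : Vec (Fin 2) M) → length σ ≤ M → [ σ ] (padded τ) →
                startsWith σ τ ≡ true
[]⇒startsWith []      τ       _        _  = refl
[]⇒startsWith (x ∷ σ) (b ∷ τ) (s≤s le) eq
  with refl , eq' ← ∷-injective eq
  rewrite []⇒startsWith σ τ le eq' = bit b
  where
  bit : ∀ (b : Fin 2) → (toℕ b ≡ᵇ toℕ b) ∧ true ≡ true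
  bit zero       = refl
  bit (suc zero) = refl

-- Unions of sets of geometrically decreasing measure.

unionBelow : ∀ {M} → (ℕ → Vec (Fin 2) M → Bool) → ℕ → Vec (Fin 2) M → Bool
unionBelow T zero    τ = false
unionBelow T (suc K) τ = unionBelow T K τ ∨ T K τ

unionBelow-⊇ : ∀ {M} (T : ℕ → Vec (Fin 2) M → Bool) {c K} → c < K → ∀ τ →
               T c τ ≡ true → unionBelow T K τ ≡ true
unionBelow-⊇ T {c} {suc K} (s≤s c≤K) τ h with m≤n⇒m<n∨m≡n c≤K
... | inj₁ c<K  rewrite unionBelow-⊇ T c<K τ h = refl
... | inj₂ refl rewrite h = ∨-zeroʳ (unionBelow T K τ)

-- The sum over c < K of 2^-(2+c) is 1/2 - 2^-(1+K); denominators are cleared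
-- and the subtraction is moved to the left.

count-unionBelow : ∀ M (T : ℕ → Vec (Fin 2) M → Bool) →
                   (∀ c → count M (T c) * 2 ^ (2 + c) ≤ 2 ^ M) →
                   ∀ K → count M (unionBelow T K) * 2 ^ (1 + K) + 2 ^ M ≤ 2 ^ M * 2 ^ K
count-unionBelow M T small zero = ≤-reflexive
  (trans (cong (λ c → c * 2 + 2 ^ M) (count-const M false)) (sym (*-identityʳ _)))
count-unionBelow M T small (suc K) = +-cancelʳ-≤ (2 ^ M) _ _ (begin
  count M (unionBelow T (suc K)) * (2 * (2 * 2 ^ K)) + 2 ^ M + 2 ^ M
    ≤⟨ +-monoˡ-≤ _ (+-monoˡ-≤ _ (*-monoˡ-≤ _ (count-∨ M (unionBelow T K) (T K)))) ⟩
  (u + t) * (2 * (2 * 2 ^ K)) + 2 ^ M + 2 ^ M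
    ≡⟨ solve 4 (λ u t k m → (u :+ t) :* (con 2 :* (con 2 :* k)) :+ m :+ m :=
         con 2 :* (u :* (con 2 :* k) :+ m) :+ t :* (con 2 :* (con 2 :* k))) refl u t (2 ^ K) (2 ^ M) ⟩
  2 * (u * 2 ^ (1 + K) + 2 ^ M) + t * 2 ^ (2 + K)
    ≤⟨ +-mono-≤ (*-monoʳ-≤ 2 (count-unionBelow M T small K)) (small K) ⟩
  2 * (2 ^ M * 2 ^ K) + 2 ^ M
    ≡⟨ solve 2 (λ k m → con 2 :* (m :* k) :+ m := m :* (con 2 :* k) :+ m) refl (2 ^ K) (2 ^ M) ⟩
  2 ^ M * 2 ^ suc K + 2 ^ M ∎)
  where
  open ≤-Reasoning
  open +-*-Solver
  u = count M (unionBelow T K)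
  t = count M (T K)

-- The summand `2 ^ M` on the left of `count-unionBelow` makes the inequality strict.
count-unionBelow-<½ : ∀ M (T : ℕ → Vec (Fin 2) M → Bool) →
                      (∀ c → count M (T c) * 2 ^ (2 + c) ≤ 2 ^ M) →
                      ∀ K → 2 * count M (unionBelow T K) < 2 ^ M
count-unionBelow-<½ M T small K = *-cancelʳ-< (2 ^ K) _ _ (begin-strict
  2 * u * 2 ^ K            ≡⟨ solve 2 (λ u k → con 2 :* u :* k := u :* (con 2 :* k)) refl u (2 ^ K) ⟩
  u * 2 ^ (1 + K)          <⟨ m<m+n _ (m^n>0 2 M) ⟩
  u * 2 ^ (1 + K) + 2 ^ M  ≤⟨ count-unionBelow M T small K ⟩
  2 ^ M * 2 ^ K            ∎)
  where
  open ≤-Reasoning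
  open +-*-Solver
  u = count M (unionBelow T K)

-- The quotient in ℚ is normalised, so the inequality is first moved to unnormalised fractions,
-- where it is a cross-multiplication.
½≤/⇒≤2* : ∀ a d .{{_ : NonZero d}} → ℚ.½ ℚ.≤ ℤ.+ a ℚ./ d → d ≤ 2 * a
½≤/⇒≤2* a (suc d) ½≤
  with ℚᵘ.*≤* le ← ℚᵘ.≤-trans (ℚ.toℚᵘ-mono-≤ ½≤)
                     (ℚᵘ.≤-reflexive (ℚ.toℚᵘ-fromℚᵘ (ℚᵘ.mkℚᵘ (ℤ.+ a) d)))
  = subst₂ _≤_ (*-identityˡ _) (*-comm a 2)
      (ℤ.drop‿+≤+ (subst (ℤ.+ (1 * suc d) ℤ.≤_) (sym (ℤ.pos-* a 2)) le))

-- Neighbourhoods given by an injective functional cover less than half.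

module _ (em : ExcludedMiddle 0ℓ) (G : Tp 2)
         (G-injective : ∀ {g g'} → 2 ≤ G g → G g ≡ G g' → g ≡ g') where

  neighbourhood : (ℕ → ℕ) → List ℕ
  neighbourhood g = overline g (G g)

  -- Indexing by the value of `G` rather than by list position absorbs repeated entries: by
  -- injectivity there is only one candidate `g` for each `c`, and its neighbourhood has length
  -- `2 + c`.
  cylinder : ∀ {M} → ℕ → Vec (Fin 2) M → Bool
  cylinder c τ with em {∃[ g ] G g ≡ 2 + c}
  ... | yes (g , _) = startsWith (neighbourhood g) τ
  ... | no _        = false

  count-cylinder : ∀ M c → count M (cylinder c) * 2 ^ (2 + c) ≤ 2 ^ M
  count-cylinder M c with em {∃[ g ] G g ≡ 2 + c}
  ... | yes (g , Gg≡) = subst (λ l → count M (startsWith (neighbourhood g)) * 2 ^ l ≤ 2 ^ M)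
          (trans (length-applyUpTo g (G g)) Gg≡) (count-startsWith M (neighbourhood g))
  ... | no _ rewrite count-const M false = z≤n

  neighbourhood⊆cylinder : ∀ {M} g c (τ : Vec (Fin 2) M) → G g ≡ 2 + c →
    startsWith (neighbourhood g) τ ≡ true → cylinder c τ ≡ true
  neighbourhood⊆cylinder g c τ Gg≡ h with em {∃[ g' ] G g' ≡ 2 + c}
  ... | no ¬h = contradiction (g , Gg≡) ¬h
  ... | yes (g' , Gg'≡)
    with refl ← G-injective {g} {g'} (subst (2 ≤_) (sym Gg≡) (m≤m+n 2 c)) (trans Gg≡ (sym Gg'≡)) = h

  lookup≤sum : ∀ gs (i : Fin (length gs)) → G (lookup gs i) ≤ sum (map G gs)
  lookup≤sum (g ∷ gs) zero    = m≤m+n _ _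
  lookup≤sum (g ∷ gs) (suc i) = ≤-trans (lookup≤sum gs i) (m≤n+m _ _)

  covered-small : ∀ gs → (∀ i → 2 ≤ G (lookup gs i)) →
                  ∀ {q} → covered G gs hasMeasure q → ¬ ℚ.½ ℚ.≤ q
  -- `K` bounds all values of `G` on the list. Hence `N + K` tosses decide both `S` and every
  -- neighbourhood, and the cylinders below `K` include them all.
  covered-small gs 2≤G (N , S , S-spec , refl) ½≤ = <⇒≱
    (count-unionBelow-<½ (N + K) cylinder (count-cylinder (N + K)) K)
    (begin
      2 ^ (N + K)                             ≡⟨ ^-distribˡ-+-* 2 N K ⟩
      2 ^ N * 2 ^ K                           ≤⟨ *-monoˡ-≤ (2 ^ K) (½≤/⇒≤2* (count N S) (2 ^ N) {{m^n≢0 2 N}} ½≤) ⟩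
      2 * count N S * 2 ^ K                   ≡⟨ solve 2 (λ s k → con 2 :* s :* k := con 2 :* (k :* s)) refl (count N S) (2 ^ K) ⟩
      2 * (2 ^ K * count N S)                 ≡⟨ cong (2 *_) (count-initial N K S) ⟨
      2 * count (N + K) (S ∘ initial N {K})   ≤⟨ *-monoʳ-≤ 2 (count-mono (N + K) S⊆union) ⟩
      2 * count (N + K) (unionBelow cylinder K) ∎)
    where
    open ≤-Reasoning
    open +-*-Solver
    K : ℕ
    K = sum (map G gs)
    S⊆union : ∀ τ → S (initial N {K} τ) ≡ true → unionBelow cylinder K τ ≡ true
    -- A favourable outcome, padded to a point of Cantor space, lies in the neighbourhood of some
    -- entry.
    S⊆union τ Sτ with i , f∈ ← Equivalence.from (S-spec (padded τ)) Sτ =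
      unionBelow-⊇ cylinder c<K τ
        (neighbourhood⊆cylinder g c τ Gg≡
          ([]⇒startsWith (neighbourhood g) τ
            (≤-trans (≤-reflexive (length-applyUpTo g (G g))) (≤-trans (lookup≤sum gs i) (m≤n+m K N))) f∈))
      where
      g : ℕ → ℕ
      g = lookup gs i
      c : ℕ
      c = G g ∸ 2
      Gg≡ : G g ≡ 2 + c
      Gg≡ = sym (m+[n∸m]≡n (2≤G i))
      c<K : c < K
      c<K = ≤-trans (≤-trans (n≤1+n (suc c)) (≤-reflexive (sym Gg≡))) (lookup≤sum gs i)

theorem3p13 : (em : ExcludedMiddle 0ℓ) → Extensionality 0ℓ 0ℓ →
    (¬ (∃[ Λ ] (WFF Λ × Λ ComputableIn (∃² em)))) ×
    ((φ : Tp 2) → ¬ (∃[ Λ ] (WFF Λ × Λ ComputableIn φ)))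
theorem3p13 em ext = notComputable (∃² em) , notComputable
  where
  notComputable : (φ : Tp 2) → ¬ (∃[ Λ ] (WFF Λ × Λ ComputableIn φ))
  notComputable φ (Λ , wff , computable) =
    -- Precision `1` suffices: the bound `1 - 1/2^1` evaluates to one half.
    covered-small em G (Good⇒injective Good-G) (Λ G 1) (entries-in-domain {Λ} computable 1)
      (proj₁ (proj₂ (wff G 1))) (proj₂ (proj₂ (wff G 1)))
    where open Partial em ext φ
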